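{- Let $A$ be an incidence matrix of a symmetric $(v,k,\lambda)$ design, and let $L$ be a Latin square of order $v$. Then the array $B$ defined by $$B(x,y,z)=A\big(x,L(y,z)\big),\qquad x,y,z\in\{1,\dots,v\},$$ is a $\mathcal{C}^3_3(v,vk,v\lambda)$-cube.
   Context: An incidence matrix of a symmetric $(v,k,\lambda)$ design is a $v\times v$ matrix over $\{0,1\}$ with exactly $k$ ones in every row and column, such that the scalar product of any two distinct rows, and of any two distinct columns, is $\lambda$. A Latin square of order $v$ is a $v\times v$ matrix over $\{1,\dots,v\}$ in which each symbol appears exactly once in every row and column. A $v\times v\times v$ array is a function on $\{1,\dots,v\}^3$. A layer is obtained by fixing one of the three coordinates; two layers are parallel if they fix the same coordinate, to different values; their scalar product is the sum over all positions of the product of corresponding entries. A $\mathcal{C}^3_3(v,K,\Lambda)$-cube is a $v\times v\times v$ array over $\{0,1\}$ such that every layer (in each of the three directions) contains exactly $K$ ones and every two parallel layers have scalar product $\Lambda$. -}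

module Defs where

open import Algebra.Properties.CommutativeMonoid.Sum using (sum)
open import Data.Fin.Base using (Fin; toℕ)
open import Data.Fin.Patterns using (0F; 1F; 2F)
open import Data.Fin.Properties using (_≟_)
open import Data.Nat.Base using (ℕ; _*_)
open import Data.Nat.Properties using (+-0-commutativeMonoid)
open import Data.Product using (∃!)
open import Data.Vec.Base using (count)
open import Data.Vec.Functional using (Vector; toVec)
open import Relation.Binary.PropositionalEquality using (_≡_; _≢_)

-- Index sets and symbol sets {1,…,v} are Fin v; the entry set {0,1} is Fin 2.

Bit : Set
Bit = Fin 2

Matrix : Set → ℕ → Set
Matrix X v = Fin v → Fin v → X

Array : Set → ℕ → Set
Array X v = Fin v → Fin v → Fin v → X

∑ : ∀ {n} → Vector ℕ n → ℕ
∑ = sum +-0-commutativeMonoid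

ones : ∀ {n} → Vector Bit n → ℕ
ones u = count (_≟ 1F) (toVec u)

infix 7 _·_ _··_

_·_ : ∀ {n} → Vector Bit n → Vector Bit n → ℕ
u · w = ∑ λ i → toℕ (u i) * toℕ (w i)

ones₂ : ∀ {v} → Matrix Bit v → ℕ
ones₂ M = ∑ λ i → ones (M i)

_··_ : ∀ {v} → Matrix Bit v → Matrix Bit v → ℕ
M ·· N = ∑ λ i → ∑ λ j → toℕ (M i j) * toℕ (N i j)

row column : ∀ {X v} → Matrix X v → Fin v → Vector X v
row    M i = λ j → M i j
column M j = λ i → M i j

record IsIncidenceMatrix (v k l : ℕ) (A : Matrix Bit v) : Set where
  field
    row-ones    : ∀ i → ones (row A i) ≡ k
    column-ones : ∀ j → ones (column A j) ≡ k
    row-product    : ∀ {i i′} → i ≢ i′ → row A i · row A i′ ≡ l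
    column-product : ∀ {j j′} → j ≢ j′ → column A j · column A j′ ≡ l

record IsLatinSquare (v : ℕ) (L : Matrix (Fin v) v) : Set where
  field
    once-in-row    : ∀ i s → ∃! _≡_ λ j → row L i j ≡ s
    once-in-column : ∀ j s → ∃! _≡_ λ i → column L j i ≡ s

-- layer d c B fixes coordinate d of B to the value c; the two remaining
-- coordinates keep their order.
layer : ∀ {X v} → Fin 3 → Fin v → Array X v → Matrix X v
layer 0F c B = λ y z → B c y z
layer 1F c B = λ x z → B x c z
layer 2F c B = λ x y → B x y c

record IsCube (v K Λ : ℕ) (B : Array Bit v) : Set where
  field
    layer-ones    : ∀ d c → ones₂ (layer d c B) ≡ K
    layer-product : ∀ d {c c′} → c ≢ c′ → layer d c B ·· layer d c′ B ≡ Λ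

-- Every line of L, read as a map from positions to symbols, is a permutation.
-- Hence a layer in the first direction consists of v rearrangements of one row
-- of A, and parallel layers are rearranged simultaneously.  A layer in either
-- of the other directions consists of all v rows of A under one rearrangement;
-- summing the scalar product of two such parallel layers over x first gives v
-- scalar products of columns of A, which are distinct columns because the
-- symbols of L in distinct positions of a line are distinct.

{-# OPTIONS --safe #-}
module Submission where

open import Defs
open import Algebra.Properties.CommutativeMonoid.Sum using (∑-comm; sum-permute)
open import Data.Fin.Base using (Fin; zero; suc; toℕ)
open import Data.Fin.Patterns using (0F; 1F; 2F)
open import Data.Fin.Permutation using (Permutation′; permutation; _⟨$⟩ʳ_)
open import Data.Nat.Base using (ℕ; zero; suc; _+_; _*_)
open import Data.Nat.Properties using (+-0-commutativeMonoid)
open import Data.Product using (∃!; _,_; proj₁; proj₂)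
open import Data.Vec.Functional using (Vector)
open import Function.Base using (_∘_)
open import Function.Definitions using (Injective)
open import Relation.Binary.PropositionalEquality
  using (_≡_; _≢_; refl; sym; trans; cong; cong₂)

∑-const : ∀ {n c} (f : Vector ℕ n) → (∀ i → f i ≡ c) → ∑ f ≡ n * c
∑-const {zero}  f f≡c = refl
∑-const {suc n} f f≡c = cong₂ _+_ (f≡c zero) (∑-const (f ∘ suc) (f≡c ∘ suc))

-- Makes `sum-permute` applicable to `ones`, which is defined by counting.
ones≡∑ : ∀ {n} (u : Vector Bit n) → ones u ≡ ∑ (toℕ ∘ u)
ones≡∑ {zero}  u = refl
ones≡∑ {suc n} u with u zero
... | 0F = ones≡∑ (u ∘ suc)
... | 1F = cong suc (ones≡∑ (u ∘ suc))

ones-permute : ∀ {n} (u : Vector Bit n) (π : Permutation′ n) →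
  ones (u ∘ (π ⟨$⟩ʳ_)) ≡ ones u
ones-permute u π = trans (ones≡∑ (u ∘ (π ⟨$⟩ʳ_)))
  (trans (sym (sum-permute +-0-commutativeMonoid (toℕ ∘ u) π)) (sym (ones≡∑ u)))

·-permute : ∀ {n} (u w : Vector Bit n) (π : Permutation′ n) →
  (u ∘ (π ⟨$⟩ʳ_)) · (w ∘ (π ⟨$⟩ʳ_)) ≡ u · w
·-permute u w π =
  sym (sum-permute +-0-commutativeMonoid (λ i → toℕ (u i) * toℕ (w i)) π)

module _ {n} {f : Fin n → Fin n} (once : ∀ s → ∃! _≡_ λ i → f i ≡ s) where

  once⇒injective : Injective _≡_ _≡_ f
  once⇒injective {i} {j} fi≡fj = trans (sym (unique fi≡fj)) (unique refl)
    where unique = proj₂ (proj₂ (once (f j)))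

  -- The inverse sends a symbol to its unique position: existence makes it a right inverse of `f`,
  -- uniqueness a left inverse.
  once⇒permutation : Permutation′ n
  once⇒permutation = permutation f (proj₁ ∘ once)
    (λ s → proj₁ (proj₂ (once s)))
    (λ i → proj₂ (proj₂ (once (f i))) refl)

module _ {v k l} {A : Matrix Bit v} (incidence : IsIncidenceMatrix v k l A) where
  open IsIncidenceMatrix incidence

  ones₂-columns-permute : (π : Permutation′ v) →
    ones₂ (λ x i → A x (π ⟨$⟩ʳ i)) ≡ v * k
  ones₂-columns-permute π =
    ∑-const _ λ x → trans (ones-permute (row A x) π) (row-ones x)

  -- Once the sums are exchanged, the inner sum at `i` is the scalar product of columns `f i` and
  -- `g i` of `A`.
  ··-columns : {f g : Fin v → Fin v} → (∀ i → f i ≢ g i) →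
    (λ x i → A x (f i)) ·· (λ x i → A x (g i)) ≡ v * l
  ··-columns {f} {g} f≢g = trans
    (∑-comm +-0-commutativeMonoid λ x i → toℕ (A x (f i)) * toℕ (A x (g i)))
    (∑-const _ λ i → column-product (f≢g i))

theorem4p1 : (v k l : ℕ) (A : Matrix Bit v) → IsIncidenceMatrix v k l A →
    (L : Matrix (Fin v) v) → IsLatinSquare v L →
    IsCube v (v * k) (v * l) (λ x y z → A x (L y z))
theorem4p1 v k l A incidence L latin = record
  { layer-ones = λ where
      0F c → ∑-const _ λ y → trans (ones-permute (row A c) (row-perm y)) (row-ones c)
      1F c → ones₂-columns-permute incidence (row-perm c)
      2F c → ones₂-columns-permute incidence (column-perm c)
  ; layer-product = λ where
      0F {c} {c′} c≢c′ → ∑-const _ λ y →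
        trans (·-permute (row A c) (row A c′) (row-perm y)) (row-product c≢c′)
      -- Here `L c z` and `L c′ z` share column `z` of `L`, so the Latin property needed is that of
      -- columns, although each layer by itself reads a row.
      1F c≢c′ → ··-columns incidence λ z →
        c≢c′ ∘ once⇒injective (once-in-column z)
      2F c≢c′ → ··-columns incidence λ y →
        c≢c′ ∘ once⇒injective (once-in-row y)
  }
  where
  open IsIncidenceMatrix incidence
  open IsLatinSquare latin

  row-perm column-perm : Fin v → Permutation′ v
  row-perm    y = once⇒permutation (once-in-row y)
  column-perm z = once⇒permutation (once-in-column z)
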